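{- Let $A(n)=\sum_{r=0}^n n!/r!$ for $n\ge0$ (so $A(n)/n!$ is the $n$th partial sum of $\sum_{r\ge0}1/r!$). Define $Q(0)=0$, $Q(1)=1$, $Q(n)=b(n)Q(n-1)+Q(n-2)$ for $n\ge2$, where $b(n)=2n/3$ if $3\mid n$ and $b(n)=1$ if $3\nmid n$. For an integer $x$ let $[x]_2$ be the largest power $2^k$ ($k\ge0$) dividing $x$, with $[0]_2=\infty$. Suppose that for every $n\ge 0$: (i) $[Q(3n)]_2\le 4[n(n+2)]_2$; (ii) $[Q(3n+1)]_2\le 2[n+1]_2$; (iii) $[Q(3n+2)]_2=1$; (iv) $[A(n)]_2\le (n+1)^2$. Then exactly two partial sums $A(m)/m!$ of the Taylor series $e=\sum_{r\ge0}1/r!$ are convergents of the simple continued fraction expansion of $e$.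
   Context: The convergents of $e$ are the rationals obtained by truncating the simple continued fraction $e=[2,1,2,1,1,4,1,1,6,1,1,8,\dots]$; their denominators are the $Q(n)$ above. A partial sum "is a convergent" if it equals one of these rationals. -}

module Defs where

open import Data.Integer.Base using (+_)
open import Data.List.Base using (applyUpTo; filter; map; upTo)
open import Data.List.Extrema.Nat using (max)
open import Data.Nat.Base
  using (ℕ; zero; suc; _+_; _*_; _^_; _/_; _!; _≤_; NonZero; >-nonZero)
open import Data.Nat.Divisibility using (_∣?_; ∣⇒≤)
open import Data.Nat.ListAction using (sum)
open import Data.Nat.DivMod using (m≥n⇒m/n>0)
open import Data.Nat.Properties using (_!≢0; ≤-trans; m≤m+n)
open import Data.Product.Base using (_×_; ∃-syntax)
open import Data.Rational.Base as ℚ using (ℚ; Positive; 1/_)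
open import Data.Rational.Properties
  using (pos+pos⇒pos; pos⇒nonZero; 1/pos⇒pos; normalize-pos)
open import Data.Sum.Base using (_⊎_)
open import Function.Base using (_∘_)
open import Relation.Binary.Construct.Add.Supremum.NonStrict _≤_
  using () renaming (_≤⁺_ to _≤∞_) public
open import Relation.Binary.PropositionalEquality.Core using (_≡_; _≢_)
open import Relation.Nullary.Construct.Add.Supremum using (_⁺; [_]; ⊤⁺) public
open import Relation.Nullary.Decidable.Core using (yes; no)

-- Each division is exact, since r ≤ n.
A : ℕ → ℕ
A n = sum (map (λ r → _/_ (n !) (r !) {{r !≢0}}) (upTo (suc n)))

partialSum : ℕ → ℚ
partialSum m = ℚ._/_ (+ A m) (m !) {{m !≢0}}

b : ℕ → ℕ
b n with 3 ∣? n
... | yes _ = 2 * n / 3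
... | no  _ = 1

Q : ℕ → ℕ
Q 0             = 0
Q 1             = 1
Q (suc (suc n)) = b (suc (suc n)) * Q (suc n) + Q n

ℕ∞ : Set
ℕ∞ = ℕ ⁺

-- The largest power of 2 dividing the argument. If 2 ^ k divides n ≠ 0 then
-- k < n, so only the exponents below n need to be considered.
[_]₂ : ℕ → ℕ∞
[ zero      ]₂ = ⊤⁺
[ n@(suc _) ]₂ = [ max 1 (filter (_∣? n) (applyUpTo (2 ^_) n)) ]

-- Multiplication by a positive integer, so that c · ∞ = ∞.
infixr 7 _·_
_·_ : (c : ℕ) .{{_ : NonZero c}} → ℕ∞ → ℕ∞
c · ⊤⁺    = ⊤⁺
c · [ x ] = [ c * x ]

-- truncation a _ k is [ a 0 , a 1 , … , a k ], for positive partial quotients.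
truncation     : (a : ℕ → ℕ) → (∀ i → NonZero (a i)) → ℕ → ℚ
truncation-pos : ∀ a a≢0 k → Positive (truncation a a≢0 k)

truncation a a≢0 zero    = + a 0 ℚ./ 1
truncation a a≢0 (suc k) = (+ a 0 ℚ./ 1) ℚ.+ (1/ tail) {{pos⇒nonZero tail {{tail>0}}}}
  where
  tail   = truncation (a ∘ suc) (a≢0 ∘ suc) k
  tail>0 = truncation-pos (a ∘ suc) (a≢0 ∘ suc) k

truncation-pos a a≢0 zero    = normalize-pos (a 0) 1 {{_}} {{a≢0 0}}
truncation-pos a a≢0 (suc k) =
  pos+pos⇒pos (+ a 0 ℚ./ 1) {{normalize-pos (a 0) 1 {{_}} {{a≢0 0}}}}
    ((1/ tail) {{pos⇒nonZero tail {{tail>0}}}}) {{1/pos⇒pos tail {{tail>0}}}}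
  where
  tail   = truncation (a ∘ suc) (a≢0 ∘ suc) k
  tail>0 = truncation-pos (a ∘ suc) (a≢0 ∘ suc) k

-- The simple continued fraction e = [2, 1, 2, 1, 1, 4, 1, 1, 6, 1, 1, 8, …].
-- The kth truncation, k ≥ 0, has denominator Q (k + 1).
e-quotient : ℕ → ℕ
e-quotient zero    = 2
e-quotient (suc k) = b (suc (suc k))

b-nonZero : ∀ n → NonZero (b (suc n))
b-nonZero n with 3 ∣? suc n
... | yes 3∣n = >-nonZero (m≥n⇒m/n>0 (≤-trans (∣⇒≤ 3∣n) (m≤m+n (suc n) _)))
... | no  _   = _

e-quotient-nonZero : ∀ k → NonZero (e-quotient k)
e-quotient-nonZero zero    = _
e-quotient-nonZero (suc k) = b-nonZero (suc k)

IsConvergentOfE : ℚ → Set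
IsConvergentOfE q = ∃[ k ] truncation e-quotient e-quotient-nonZero k ≡ q

ExactlyTwo : {X : Set} → (X → Set) → Set
ExactlyTwo P =
  ∃[ x ] ∃[ y ] x ≢ y × P x × P y × (∀ z → P z → z ≡ x ⊎ z ≡ y)

{-# OPTIONS --safe #-}
module Submission where

-- Let A(m)/m! be the convergent with denominator Q(j), which is in lowest terms.
-- Then Q(j) ≤ m!, and m! divides A(m) Q(j). Writing j = 3n + r with r < 3, the first
-- fact forces n < m, because Q(3n) > n! for n ≥ 1, so the hypotheses bound the 2-parts of
-- A(m) and Q(j) by (m + 1)² and 4m². But 2^⌊m/2⌋ divides m!, whence
-- 2^⌊m/2⌋ ≤ 4m²(m + 1)², which fails for m ≥ 50. The remaining pairs, with m < 50
-- and j ≤ 3(m + 1), are settled by computation.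

open import Defs
open import Data.Nat.Base using (ℕ; _+_; _*_; _^_)
open import Data.Product.Base using (_×_; ∃-syntax)
open import Data.Rational.Base using (ℚ)
open import Relation.Binary.PropositionalEquality.Core using (_≡_)

open import Data.Empty using (⊥)
open import Data.Fin.Base using (Fin; toℕ)
open import Data.Fin.Properties using (toℕ<n)
open import Data.Fin.Patterns using (0F; 1F; 2F)
open import Data.Integer.Base as ℤ using (+_; +[1+_])
import Data.Integer.Properties as ℤ
open import Data.List.Base using (applyUpTo; filter)
open import Data.List.Extrema.Nat using (max≤v⁺; v≤max⁺)
open import Data.List.Membership.Propositional.Properties
  using (∈-applyUpTo⁺; ∈-filter⁺)
open import Data.List.Membership.Propositional using (lose)
import Data.List.Relation.Unary.All as All
open import Data.List.Relation.Unary.All.Properties using (all-filter)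
open import Data.Nat.Base
open import Data.Nat.Coprimality using (Coprime; coprime-divisor)
import Data.Nat.Coprimality as Coprimality
open import Data.Nat.Divisibility
open import Data.Nat.DivMod using (m*n/n≡m; _divMod_; result; m≡m%n+[m/n]*n; m%n<n; /-mono-≤)
open import Data.Nat.Primality using (Prime; prime[2]; euclidsLemma; prime⇒nonZero)
open import Data.Nat.Properties
open import Data.Nat.Tactic.RingSolver using (solve-∀)
open import Data.Product.Base using (_,_)
open import Data.Rational.Base as ℚ using (toℚᵘ)
open import Data.Rational.Properties
  using (toℚᵘ-homo-+; toℚᵘ-homo-1/; toℚᵘ-fromℚᵘ; toℚᵘ-cong)
open import Data.Rational.Unnormalised.Base as ℚᵘ using (mkℚᵘ; *≡*)
import Data.Rational.Unnormalised.Properties as ℚᵘ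
open import Data.Sum.Base using (_⊎_; inj₁; inj₂)
open import Function.Base using (_∘_; _$_)
open import Relation.Binary.Construct.Add.Supremum.NonStrict _≤_
  using ([_]; ≤⁺-trans)
open import Relation.Binary.PropositionalEquality
  using (refl; sym; trans; cong; cong₂; subst; module ≡-Reasoning)
open import Relation.Nullary.Decidable using (yes; no; toWitness; _→-dec_; _⊎-dec_)
open import Relation.Nullary.Negation using (contradiction)

-- Continuants

-- K a n is the numerator of [ a 0 , … , a (n ∸ 1) ].
K : (ℕ → ℕ) → ℕ → ℕ
K a 0             = 1
K a 1             = a 0
K a (suc (suc n)) = a 0 * K (a ∘ suc) (suc n) + K (a ∘ suc ∘ suc) n

-- `K` unfolds at the front, as `truncation` does, whereas `Q` recurs at the back. Euler's symmetry
-- of continuants links the two.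
K-snoc : ∀ a n → K a (2 + n) ≡ a (1 + n) * K a (1 + n) + K a n
K-snoc a 0 = cong (_+ 1) (*-comm (a 0) (a 1))
K-snoc a 1 = lemma (a 0) (a 1) (a 2)
  where
  lemma : ∀ x y z → x * (y * z + 1) + z ≡ z * (x * y + 1) + x
  lemma = solve-∀
K-snoc a (suc (suc n)) = begin
  a 0 * K (a ∘ suc) (3 + n) + K (a ∘ suc ∘ suc) (2 + n)
    ≡⟨ cong₂ (λ x y → a 0 * x + y) (K-snoc (a ∘ suc) (suc n)) (K-snoc (a ∘ suc ∘ suc) n) ⟩
  a 0 * (a (3 + n) * K (a ∘ suc) (2 + n) + K (a ∘ suc) (1 + n))
    + (a (3 + n) * K (a ∘ suc ∘ suc) (1 + n) + K (a ∘ suc ∘ suc) n)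
    ≡⟨ lemma (a 0) (a (3 + n)) (K (a ∘ suc) (2 + n)) _ _ _ ⟩
  a (3 + n) * (a 0 * K (a ∘ suc) (2 + n) + K (a ∘ suc ∘ suc) (1 + n))
    + (a 0 * K (a ∘ suc) (1 + n) + K (a ∘ suc ∘ suc) n) ∎
  where
  open ≡-Reasoning
  lemma : ∀ x y p q r s → x * (y * p + q) + (y * r + s) ≡ y * (x * p + r) + (x * q + s)
  lemma = solve-∀

K-nonZero : ∀ a → (∀ i → NonZero (a i)) → ∀ n → NonZero (K a n)
K-nonZero a a≢0 0             = _
K-nonZero a a≢0 1             = a≢0 0
K-nonZero a a≢0 (suc (suc n)) = >-nonZero (≤-trans
  (>-nonZero⁻¹ (a 0 * K (a ∘ suc) (suc n))
    {{m*n≢0 (a 0) _ {{a≢0 0}} {{K-nonZero (a ∘ suc) (a≢0 ∘ suc) (suc n)}}}})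
  (m≤m+n _ _))

-- One Euclidean step carries a common divisor to the pair for the shifted sequence, until the
-- second entry is `K _ 0 = 1`.
K-coprime : ∀ a n → Coprime (K a (suc n)) (K (a ∘ suc) n)
K-coprime a zero    (_ , d∣1) = ∣1⇒≡1 d∣1
K-coprime a (suc n) (d∣K , d∣K′) =
  K-coprime (a ∘ suc) n (d∣K′ , ∣m+n∣m⇒∣n d∣K (∣n⇒∣m*n (a 0) d∣K′))

-- Without the leading 2 the quotients are `b 2`, `b 3`, ..., the coefficients in the recurrence of
-- `Q`.
K-denominator : ∀ k → K (e-quotient ∘ suc) k ≡ Q (suc k)
K-denominator 0             = refl
K-denominator 1             = refl
K-denominator (suc (suc k)) = trans (K-snoc (e-quotient ∘ suc) k)
  (cong₂ (λ x y → b (3 + k) * x + y) (K-denominator (suc k)) (K-denominator k))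

-- Unnormalised fractions up to `≃` spare any reduction of `n` and `d` to lowest terms.
prepend-quotient : ∀ a q .{{_ : ℚ.NonZero q}} n d .{{_ : NonZero n}} .{{_ : NonZero d}} →
  toℚᵘ q ℚᵘ.≃ + n ℚᵘ./ d →
  toℚᵘ ((+ a ℚ./ 1) ℚ.+ ℚ.1/ q) ℚᵘ.≃ + (a * n + d) ℚᵘ./ n
prepend-quotient a q n@(suc n-1) d@(suc d-1) q≃n/d = begin
  toℚᵘ ((+ a ℚ./ 1) ℚ.+ ℚ.1/ q)          ≈⟨ toℚᵘ-homo-+ (+ a ℚ./ 1) (ℚ.1/ q) ⟩
  toℚᵘ (+ a ℚ./ 1) ℚᵘ.+ toℚᵘ (ℚ.1/ q)    ≈⟨ ℚᵘ.+-cong (toℚᵘ-fromℚᵘ (mkℚᵘ (+ a) 0)) (reciprocal q q≃n/d) ⟩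
  mkℚᵘ (+ a) 0 ℚᵘ.+ mkℚᵘ (+ d) n-1       ≈⟨ *≡* (cong₂ ℤ._*_ numerators (cong +_ (sym (*-identityˡ n)))) ⟩
  + (a * n + d) ℚᵘ./ n                   ∎
  where
  open ℚᵘ.≃-Reasoning
  reciprocal : ∀ q .{{_ : ℚ.NonZero q}} → toℚᵘ q ℚᵘ.≃ mkℚᵘ (+ n) d-1 →
               toℚᵘ (ℚ.1/ q) ℚᵘ.≃ mkℚᵘ (+ d) n-1
  -- No other numerator is possible, as `q` equals the positive fraction `n / d`.
  reciprocal (ℚ.mkℚ +[1+ i ] j _) (*≡* eq) =
    *≡* (trans (ℤ.*-comm (+ suc j) (+ n)) (trans (sym eq) (ℤ.*-comm (+ suc i) (+ d))))
  numerators : + a ℤ.* + n ℤ.+ + d ℤ.* + 1 ≡ + (a * n + d)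
  numerators = trans (cong₂ ℤ._+_ (sym (ℤ.pos-* a n)) (ℤ.*-identityʳ (+ d))) (sym (ℤ.pos-+ (a * n) d))

truncation-≃ : ∀ a a≢0 k →
  toℚᵘ (truncation a a≢0 k) ℚᵘ.≃
  (+ K a (suc k) ℚᵘ./ K (a ∘ suc) k) {{K-nonZero (a ∘ suc) (a≢0 ∘ suc) k}}
truncation-≃ a a≢0 zero    = toℚᵘ-fromℚᵘ (mkℚᵘ (+ a 0) 0)
truncation-≃ a a≢0 (suc k) =
  prepend-quotient (a 0) _ {{_}} (K (a ∘ suc) (suc k)) (K (a ∘ suc ∘ suc) k)
    {{K-nonZero (a ∘ suc) (a≢0 ∘ suc) (suc k)}}
    {{K-nonZero (a ∘ suc ∘ suc) (a≢0 ∘ suc ∘ suc) k}}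
    (truncation-≃ (a ∘ suc) (a≢0 ∘ suc) k)

/-≃⇒*≡* : ∀ m n o p .{{_ : NonZero n}} .{{_ : NonZero p}} →
          + m ℚᵘ./ n ℚᵘ.≃ + o ℚᵘ./ p → m * p ≡ o * n
/-≃⇒*≡* m (suc n) o (suc p) (*≡* eq) =
  ℤ.+-injective (trans (ℤ.pos-* m (suc p)) (trans eq (sym (ℤ.pos-* o (suc n)))))

toℚᵘ-/ : ∀ i n .{{_ : NonZero n}} → toℚᵘ (i ℚ./ n) ℚᵘ.≃ i ℚᵘ./ n
toℚᵘ-/ i (suc n) = toℚᵘ-fromℚᵘ (mkℚᵘ i n)

convergent⇒cross : ∀ m k → truncation e-quotient e-quotient-nonZero k ≡ partialSum m →
                   A m * Q (suc k) ≡ K e-quotient (suc k) * m !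
convergent⇒cross m k eq = subst (λ q → A m * q ≡ K e-quotient (suc k) * m !) (K-denominator k) $
  /-≃⇒*≡* (A m) (m !) (K e-quotient (suc k)) (K (e-quotient ∘ suc) k)
    {{m !≢0}} {{K-nonZero (e-quotient ∘ suc) (e-quotient-nonZero ∘ suc) k}} $
  ℚᵘ.≃-trans (ℚᵘ.≃-sym (toℚᵘ-/ (+ A m) (m !) {{m !≢0}})) $
  ℚᵘ.≃-trans (toℚᵘ-cong (sym eq)) $
  truncation-≃ e-quotient e-quotient-nonZero k

-- `Q (suc k)` divides the right-hand side and is coprime to its first factor, so it divides `m !`.
cross⇒denominator≤ : ∀ m k → A m * Q (suc k) ≡ K e-quotient (suc k) * m ! → Q (suc k) ≤ m !
cross⇒denominator≤ m k eq = ∣⇒≤ {{m !≢0}} $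
  coprime-divisor
    (Coprimality.sym (subst (Coprime (K e-quotient (suc k))) (K-denominator k) (K-coprime e-quotient k)))
    (divides (A m) (sym eq))

-- Growth of Q

b-3* : ∀ {k} n → k ≡ n * 3 → b k ≡ 2 * n
b-3* {k} n refl with 3 ∣? k
... | yes _  = trans (cong (_/ 3) (sym (*-assoc 2 n 3))) (m*n/n≡m (2 * n) 3)
... | no 3∤k = contradiction (divides n refl) 3∤k

Q-≤-suc : ∀ n → Q n ≤ Q (suc n)
Q-≤-suc zero    = z≤n
Q-≤-suc (suc n) = ≤-trans (m≤n*m (Q (suc n)) (b (2 + n)) {{b-nonZero (suc n)}}) (m≤m+n _ _)

Q-mono-+ : ∀ r n → Q n ≤ Q (r + n)
Q-mono-+ zero    n = ≤-refl
Q-mono-+ (suc r) n = ≤-trans (Q-mono-+ r n) (Q-≤-suc (r + n))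

-- The quotient `b ((2 + n) * 3) = 2 * (2 + n)` alone outweighs the factor `2 + n` that the
-- factorial gains.
!<Q : ∀ n → suc n ! < Q (suc n * 3)
!<Q zero    = s≤s (s≤s z≤n)
!<Q (suc n) = begin-strict
  (2 + n) * suc n !                      <⟨ *-monoʳ-< (2 + n) (!<Q n) ⟩
  (2 + n) * Q (suc n * 3)                ≤⟨ *-mono-≤ (m≤m+n (2 + n) _) (Q-mono-+ 2 (suc n * 3)) ⟩
  2 * (2 + n) * Q (2 + suc n * 3)        ≡⟨ cong (_* Q (2 + suc n * 3)) (b-3* (2 + n) refl) ⟨
  b ((2 + n) * 3) * Q (2 + suc n * 3)    ≤⟨ m≤m+n _ _ ⟩
  Q ((2 + n) * 3)                        ∎
  where open ≤-Reasoning

!-mono-≤ : ∀ {m n} → m ≤ n → m ! ≤ n !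
!-mono-≤ {n = n} m≤n = ∣⇒≤ {{n !≢0}} (m≤n⇒m!∣n! m≤n)

Q≤!⇒< : ∀ m .{{_ : NonZero m}} n r → Q (r + n * 3) ≤ m ! → n < m
Q≤!⇒< m zero    r _    = >-nonZero⁻¹ m
Q≤!⇒< m (suc n) r Q≤m! = ≰⇒> λ m≤1+n → n≮n (suc n !) $ begin-strict
  suc n !              <⟨ !<Q n ⟩
  Q (suc n * 3)        ≤⟨ Q-mono-+ r (suc n * 3) ⟩
  Q (r + suc n * 3)    ≤⟨ Q≤m! ⟩
  m !                  ≤⟨ !-mono-≤ m≤1+n ⟩
  suc n !              ∎
  where open ≤-Reasoning

-- Powers of 2

-- Euclid's lemma hands the factors `p` to `u` or `v` one at a time. This stands in for
-- multiplicativity of 2-parts.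
^∣*⇒split : ∀ {p} → Prime p → ∀ h u v → p ^ h ∣ u * v →
            ∃[ s ] ∃[ t ] s + t ≡ h × p ^ s ∣ u × p ^ t ∣ v
^∣*⇒split     pr zero    u v _     = 0 , 0 , refl , 1∣ u , 1∣ v
^∣*⇒split {p} pr (suc h) u v p^∣uv
  with euclidsLemma u v pr (∣-trans (m∣m*n (p ^ h)) p^∣uv)
... | inj₁ (divides-refl u′) =
  let s , t , s+t≡h , p^s∣u′ , p^t∣v = ^∣*⇒split pr h u′ v
        (*-cancelˡ-∣ p {{prime⇒nonZero pr}} (subst (p ^ suc h ∣_) (lemma u′ p v) p^∣uv))
  in suc s , t , cong suc s+t≡h , subst (p ^ suc s ∣_) (*-comm p u′) (*-monoʳ-∣ p p^s∣u′) , p^t∣v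
  where
  lemma : ∀ x y z → x * y * z ≡ y * (x * z)
  lemma = solve-∀
... | inj₂ (divides-refl v′) =
  let s , t , s+t≡h , p^s∣u , p^t∣v′ = ^∣*⇒split pr h u v′
        (*-cancelˡ-∣ p {{prime⇒nonZero pr}} (subst (p ^ suc h ∣_) (lemma u v′ p) p^∣uv))
  in s , suc t , trans (+-suc s t) (cong suc s+t≡h) , p^s∣u ,
     subst (p ^ suc t ∣_) (*-comm p v′) (*-monoʳ-∣ p p^t∣v′)
  where
  lemma : ∀ x y z → x * (y * z) ≡ z * (x * y)
  lemma = solve-∀

n<2^n : ∀ n → n < 2 ^ n
n<2^n zero    = s≤s z≤n
n<2^n (suc n) = +-mono-≤ (m^n>0 2 n) (≤-trans (n<2^n n) (m≤m+n _ 0))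

-- Since `s < 2 ^ s ≤ u`, the power `2 ^ s` is in the list whose maximum is `[ u ]₂`. The case
-- `u = 0` is void, as ∞ is not below `[ x ]`.
2^∣⇒≤ : ∀ s {u x} → 2 ^ s ∣ u → [ u ]₂ ≤∞ [ x ] → 2 ^ s ≤ x
2^∣⇒≤ s {suc u} 2^s∣u [ [u]₂≤x ] = ≤-trans
  (v≤max⁺ 1 _ (inj₂ (lose
    (∈-filter⁺ (_∣? suc u) (∈-applyUpTo⁺ (2 ^_) (≤-trans (n<2^n s) (∣⇒≤ 2^s∣u))) 2^s∣u) ≤-refl)))
  [u]₂≤x

-- A divisor of `v ≠ 0` is at most `v`; this crude bound makes the hypotheses on `Q` polynomial.
·[]₂≤ : ∀ c .{{_ : NonZero c}} v .{{_ : NonZero v}} → c · [ v ]₂ ≤∞ [ c * v ]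
·[]₂≤ c v@(suc _) = [ *-monoʳ-≤ c (max≤v⁺ {xs = filter (_∣? v) (applyUpTo (2 ^_) v)} (s≤s z≤n)
  (All.map ∣⇒≤ (all-filter (_∣? v) (applyUpTo (2 ^_) v)))) ]

2^h∣[h*2]! : ∀ h → 2 ^ h ∣ (h * 2) !
2^h∣[h*2]! zero    = ∣-refl
2^h∣[h*2]! (suc h) = *-pres-∣ {m = suc h * 2} (n∣m*n (suc h)) (∣n⇒∣m*n (suc (h * 2)) (2^h∣[h*2]! h))

-- Partial sums with m ≥ 50

-- The lower terms of the expansion total at most (4 + 6 + 4 + 1)x³ = 15x³, which is at most x⁴.
[1+x]⁴≤2x⁴ : ∀ x → 15 ≤ x → suc x * suc x * (suc x * suc x) ≤ 2 * (x * x * (x * x))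
[1+x]⁴≤2x⁴ x@(suc y) 15≤x = begin
  suc x * suc x * (suc x * suc x)
    ≤⟨ m≤m+n _ _ ⟩
  -- The added polynomial is 15x³ - (4x³ + 6x² + 4x + 1) at x = 1 + y, where no coefficient is
  -- negative.
  suc x * suc x * (suc x * suc x) + (11 * (y * y * y) + 27 * (y * y) + 17 * y)
    ≡⟨ lemma y ⟩
  x * x * (x * x) + 15 * (x * (x * x))
    ≤⟨ +-monoʳ-≤ (x * x * (x * x)) (*-monoˡ-≤ (x * (x * x)) 15≤x) ⟩
  x * x * (x * x) + x * (x * (x * x))
    ≡⟨ lemma₂ x ⟩
  2 * (x * x * (x * x)) ∎
  where
  open ≤-Reasoning
  lemma : ∀ y → (2 + y) * (2 + y) * ((2 + y) * (2 + y)) + (11 * (y * y * y) + 27 * (y * y) + 17 * y)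
              ≡ (1 + y) * (1 + y) * ((1 + y) * (1 + y)) + 15 * ((1 + y) * ((1 + y) * (1 + y)))
  lemma = solve-∀
  lemma₂ : ∀ x → x * x * (x * x) + x * (x * (x * x)) ≡ 2 * (x * x * (x * x))
  lemma₂ = solve-∀

64x⁴<2^h-step : ∀ x h → 15 ≤ x → 64 * (x * x * (x * x)) < 2 ^ h →
                64 * (suc x * suc x * (suc x * suc x)) < 2 ^ suc h
64x⁴<2^h-step x h 15≤x 64x⁴<2^h = begin-strict
  64 * (suc x * suc x * (suc x * suc x)) ≤⟨ *-monoʳ-≤ 64 ([1+x]⁴≤2x⁴ x 15≤x) ⟩
  64 * (2 * (x * x * (x * x)))           ≡⟨ *-assoc 64 2 (x * x * (x * x)) ⟨
  2 * 64 * (x * x * (x * x))             ≡⟨ *-assoc 2 64 (x * x * (x * x)) ⟩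
  2 * (64 * (x * x * (x * x)))           <⟨ *-monoʳ-< 2 64x⁴<2^h ⟩
  2 * 2 ^ h                              ∎
  where open ≤-Reasoning

-- The right side doubles at each step and the left at most doubles. The inequality still fails at
-- `h = 24`, whence the threshold 50 = 2 * 25 for `m`.
64[1+h]⁴<2^h : ∀ {h} → 25 ≤′ h → 64 * (suc h * suc h * (suc h * suc h)) < 2 ^ h
64[1+h]⁴<2^h (≤′-reflexive refl)  = <ᵇ⇒< _ _ _
64[1+h]⁴<2^h (≤′-step {h} 25≤′h) = 64x⁴<2^h-step (suc h) h
  (≤-trans (m≤m+n 15 10) (≤-trans (≤′⇒≤ 25≤′h) (n≤1+n h))) (64[1+h]⁴<2^h 25≤′h)

module _
  (v₂Q0 : ∀ n → [ Q (3 * n) ]₂ ≤∞ 4 · [ n * (n + 2) ]₂)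
  (v₂Q1 : ∀ n → [ Q (3 * n + 1) ]₂ ≤∞ 2 · [ n + 1 ]₂)
  (v₂Q2 : ∀ n → [ Q (3 * n + 2) ]₂ ≡ [ 1 ])
  (v₂A  : ∀ n → [ A n ]₂ ≤∞ [ (n + 1) ^ 2 ])
  where

  -- One bound serves all three residues, the largest case being n(n + 2) < (n + 1)² ≤ m². Index 0
  -- is excluded because every power of 2 divides `Q 0 = 0`.
  2^∣Q⇒≤ : ∀ s (r : Fin 3) n m → n < m → NonZero (toℕ r + n * 3) →
           2 ^ s ∣ Q (toℕ r + n * 3) → 2 ^ s ≤ 4 * (m * m)
  2^∣Q⇒≤ s 0F n@(suc _) m n<m _ 2^s∣Q = begin
    2 ^ s               ≤⟨ 2^∣⇒≤ s 2^s∣Q (subst (λ i → [ Q i ]₂ ≤∞ [ 4 * (n * (n + 2)) ]) (*-comm 3 n)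
                             (≤⁺-trans ≤-trans (v₂Q0 n) (·[]₂≤ 4 (n * (n + 2))))) ⟩
    4 * (n * (n + 2))   ≤⟨ *-monoʳ-≤ 4 (≤-trans (n≤1+n _) (≤-reflexive (lemma n))) ⟩
    4 * (suc n * suc n) ≤⟨ *-monoʳ-≤ 4 (*-mono-≤ n<m n<m) ⟩
    4 * (m * m)         ∎
    where
    open ≤-Reasoning
    lemma : ∀ n → suc (n * (n + 2)) ≡ suc n * suc n
    lemma = solve-∀
  2^∣Q⇒≤ s 1F n m@(suc _) n<m _ 2^s∣Q = begin
    2 ^ s         ≤⟨ 2^∣⇒≤ s 2^s∣Q (subst (λ i → [ Q i ]₂ ≤∞ [ 2 * (n + 1) ]) (trans (+-comm (3 * n) 1) (cong suc (*-comm 3 n)))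
                       (≤⁺-trans ≤-trans (v₂Q1 n) (·[]₂≤ 2 (n + 1) {{>-nonZero (m≤n+m 1 n)}}))) ⟩
    2 * (n + 1)   ≤⟨ *-mono-≤ {2} {4} (s≤s (s≤s z≤n)) (≤-trans (≤-reflexive (+-comm n 1)) n<m) ⟩
    4 * m         ≤⟨ *-monoʳ-≤ 4 (m≤m*n m m) ⟩
    4 * (m * m)   ∎
    where open ≤-Reasoning
  2^∣Q⇒≤ s 2F n m@(suc _) n<m _ 2^s∣Q = begin
    2 ^ s         ≤⟨ 2^∣⇒≤ s 2^s∣Q (subst (λ i → [ Q i ]₂ ≤∞ [ 1 ]) (trans (+-comm (3 * n) 2) (cong (suc ∘ suc) (*-comm 3 n)))
                       (subst (_≤∞ [ 1 ]) (sym (v₂Q2 n)) [ ≤-refl ])) ⟩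
    1             ≤⟨ s≤s z≤n ⟩
    4 * (m * m)   ∎
    where open ≤-Reasoning

  cross⇒m<50 : ∀ m k → A m * Q (suc k) ≡ K e-quotient (suc k) * m ! → m < 50
  cross⇒m<50 m k eq = ≰⇒> λ 50≤m → large 50≤m
    where
    h = m / 2

    m≤1+2h : m ≤ 1 + h * 2
    m≤1+2h = ≤-trans (≤-reflexive (m≡m%n+[m/n]*n m 2)) (+-monoˡ-≤ (h * 2) (s≤s⁻¹ (m%n<n m 2)))

    2h≤m : h * 2 ≤ m
    2h≤m = ≤-trans (m≤n+m (h * 2) (m % 2)) (≤-reflexive (sym (m≡m%n+[m/n]*n m 2)))

    2^h∣AQ : 2 ^ h ∣ A m * Q (suc k)
    2^h∣AQ = ∣-trans (2^h∣[h*2]! h) (∣-trans (m≤n⇒m!∣n! 2h≤m) (divides (K e-quotient (suc k)) eq))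

    large : 50 ≤ m → ⊥
    large 50≤m
      with suc k divMod 3 | ^∣*⇒split prime[2] h (A m) (Q (suc k)) 2^h∣AQ
    ... | result n r k≡ | s , t , s+t≡h , 2^s∣A , 2^t∣Q = n≮n (2 ^ h) $ begin-strict
      2 ^ h                                   ≡⟨ cong (2 ^_) s+t≡h ⟨
      2 ^ (s + t)                             ≡⟨ ^-distribˡ-+-* 2 s t ⟩
      2 ^ s * 2 ^ t                           ≤⟨ *-mono-≤ (2^∣⇒≤ s 2^s∣A (v₂A m)) 2^t≤ ⟩
      -- Both `m` and `m + 1` are at most `2 * suc h`, which gives the constant 2² * 4 * 2² = 64.
      (m + 1) ^ 2 * (4 * (m * m))             ≤⟨ *-mono-≤ (^-monoˡ-≤ 2 (+-monoˡ-≤ 1 m≤1+2h)) (*-monoʳ-≤ 4 (*-mono-≤ m≤ m≤)) ⟩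
      (1 + h * 2 + 1) ^ 2 * (4 * ((2 * suc h) * (2 * suc h)))  ≡⟨ lemma h ⟩
      64 * (suc h * suc h * (suc h * suc h))  <⟨ 64[1+h]⁴<2^h (≤⇒≤′ (/-mono-≤ 50≤m (≤-refl {2}))) ⟩
      2 ^ h                                   ∎
      where
      open ≤-Reasoning
      instance
        m≢0 : NonZero m
        m≢0 = >-nonZero (≤-trans (s≤s z≤n) 50≤m)

      n<m : n < m
      n<m = Q≤!⇒< m n (toℕ r) (subst (λ i → Q i ≤ m !) k≡ (cross⇒denominator≤ m k eq))

      2^t≤ : 2 ^ t ≤ 4 * (m * m)
      2^t≤ = 2^∣Q⇒≤ t r n m n<m (subst NonZero k≡ _) (subst (λ i → 2 ^ t ∣ Q i) k≡ 2^t∣Q)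

      m≤ : m ≤ 2 * suc h
      m≤ = ≤-trans m≤1+2h (≤-trans (n≤1+n _) (≤-reflexive (*-comm (suc h) 2)))

      lemma : ∀ h → (1 + h * 2 + 1) * ((1 + h * 2 + 1) * 1) * (4 * ((2 * suc h) * (2 * suc h)))
                  ≡ 64 * (suc h * suc h * (suc h * suc h))
      lemma = solve-∀

-- Partial sums with m < 50

-- The value at n of f 0 = x, f 1 = y, f (2 + i) = c i * f (1 + i) + f i. Evaluating Q or K
-- by their definitions would take exponential time.
recur : (ℕ → ℕ) → ℕ → ℕ → ℕ → ℕ
recur c x y zero    = x
recur c x y (suc n) = recur (c ∘ suc) y (c 0 * y + x) n

recur-correct : ∀ (f c : ℕ → ℕ) → (∀ i → f (2 + i) ≡ c i * f (1 + i) + f i) →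
                ∀ n → recur c (f 0) (f 1) n ≡ f n
recur-correct f c f-rec zero    = refl
recur-correct f c f-rec (suc n) =
  trans (cong (λ z → recur (c ∘ suc) (f 1) z n) (sym (f-rec 0)))
        (recur-correct (f ∘ suc) (c ∘ suc) (f-rec ∘ suc) n)

P Q′ : ℕ → ℕ
P  = recur (e-quotient ∘ suc) 1 2
Q′ = recur (b ∘ suc ∘ suc) 0 1

P≡K : ∀ n → P n ≡ K e-quotient n
P≡K = recur-correct (K e-quotient) (e-quotient ∘ suc) (K-snoc e-quotient)

Q′≡Q : ∀ n → Q′ n ≡ Q n
Q′≡Q = recur-correct Q (b ∘ suc ∘ suc) (λ _ → refl)

-- Decided by evaluating every pair, which the linear-time `P` and `Q′` make feasible.
cross-small : ∀ {m} → m < 50 → ∀ {k} → k < suc m * 3 →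
              A m * Q′ (suc k) ≡ P (suc k) * m ! → m ≡ 1 ⊎ m ≡ 3
cross-small = toWitness {a? = allUpTo? (λ m → allUpTo? (λ k →
  (A m * Q′ (suc k) ≟ P (suc k) * m !) →-dec ((m ≟ 1) ⊎-dec (m ≟ 3))) (suc m * 3)) 50} _

-- This leaves finitely many `k` to check for each `m`.
Q≤!⇒<3* : ∀ m .{{_ : NonZero m}} k → Q (suc k) ≤ m ! → k < m * 3
Q≤!⇒<3* m k Q≤m! with suc k divMod 3
... | result n r k≡ = begin
  suc k            ≡⟨ k≡ ⟩
  toℕ r + n * 3    ≤⟨ +-monoˡ-≤ (n * 3) (<⇒≤ (toℕ<n r)) ⟩
  suc n * 3        ≤⟨ *-monoˡ-≤ 3 (Q≤!⇒< m n (toℕ r) (subst (λ i → Q i ≤ m !) k≡ Q≤m!)) ⟩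
  m * 3            ∎
  where open ≤-Reasoning

theoremA4 : (∀ (n : ℕ) → [ Q (3 * n) ]₂ ≤∞ 4 · [ n * (n + 2) ]₂) →
    (∀ (n : ℕ) → [ Q (3 * n + 1) ]₂ ≤∞ 2 · [ n + 1 ]₂) →
    (∀ (n : ℕ) → [ Q (3 * n + 2) ]₂ ≡ [ 1 ]) →
    (∀ (n : ℕ) → [ A n ]₂ ≤∞ [ (n + 1) ^ 2 ]) →
    ExactlyTwo (λ (m : ℕ) → IsConvergentOfE (partialSum m))
-- The two convergents are 2 = [2] and 16/6 = 8/3 = [2, 1, 2].
theoremA4 v₂Q0 v₂Q1 v₂Q2 v₂A = 1 , 3 , (λ ()) , (0 , refl) , (2 , refl) , onlyTwo
  where
  onlyTwo : ∀ m → IsConvergentOfE (partialSum m) → m ≡ 1 ⊎ m ≡ 3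
  onlyTwo m (k , conv) = cross-small
    -- The bound on `k` needs a nonzero argument and `m` may be 0, so it is applied to `suc m`.
    m<50 (Q≤!⇒<3* (suc m) k (≤-trans (cross⇒denominator≤ m k eq) (!-mono-≤ (n≤1+n m))))
    (subst (λ q → A m * q ≡ P (suc k) * m !) (sym (Q′≡Q (suc k)))
      (subst (λ p → A m * Q (suc k) ≡ p * m !) (sym (P≡K (suc k))) eq))
    where
    eq   = convergent⇒cross m k conv
    m<50 = cross⇒m<50 v₂Q0 v₂Q1 v₂Q2 v₂A m k eq
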